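{- Let $M$ be a simple matroid on $[n]$ of rank $\ell\ge3$. If $M$ is $3$-independent, then $M$ is line-closed.
   Context: A simple matroid has no loops and no nontrivial parallel classes; $[n]=\{1,\dots,n\}$. For $3\le p\le \ell+1$, a partition $\pi$ of $[n]$ is $p$-independent if, whenever one chooses at most $p$ parts of $\pi$ and one element from each of them, the chosen elements form an independent set of $M$. A partition is independent if it is $(\ell+1)$-independent. For $3\le p\le\ell$, the matroid $M$ is $p$-independent if every $p$-independent partition of $[n]$ is independent. A subset $S\subset[n]$ is line-closed if for every $3$-element dependent set (3-circuit) $C$ of $M$ with $|S\cap C|\ge2$ one has $C\subset S$. The matroid $M$ is line-closed if every line-closed subset of $[n]$ is a flat of $M$. -}

module Defs where

open import Data.Fin.Base using (Fin)
open import Data.Fin.Subset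
open import Data.Fin.Subset.Properties using (_⊆?_)
open import Data.List.Base using (List; []; _∷_; _++_; map; filter; tabulate)
open import Data.List.Extrema.Nat using (max)
open import Data.Nat.Base using (ℕ; zero; suc; _≤_; _<_)
open import Data.Product.Base using (∃; _×_)
open import Data.Product using (∃!)
import Data.Vec.Base as Vec
open import Function.Definitions using (Injective)
open import Relation.Binary.PropositionalEquality using (_≡_; _≢_)
open import Relation.Nullary.Negation using (¬_)
open import Relation.Unary using (Decidable)

-- The ground set [n] is Fin n.  Independence is required to be decidable, as
-- it is classically for any family of subsets of a finite set.
record Matroid (n : ℕ) : Set₁ where
  field
    Independent : Subset n → Set
    independent? : Decidable Independent
    ⊥-independent : Independent ⊥
    hereditary : ∀ {I J} → I ⊆ J → Independent J → Independent I
    exchange : ∀ {I J} → Independent I → Independent J → ∣ I ∣ < ∣ J ∣ →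
               ∃ λ x → x ∈ J × x ∉ I × Independent (I ∪ ⁅ x ⁆)

subsets : ∀ n → List (Subset n)
subsets zero = Vec.[] ∷ []
subsets (suc n) = map (outside Vec.∷_) (subsets n) ++ map (inside Vec.∷_) (subsets n)

-- Parts are nonempty and every element lies in exactly one of them, so
-- distinct indices name distinct parts.
record Partition (n : ℕ) : Set where
  field
    size : ℕ
    part : Fin size → Subset n
    nonempty : ∀ i → Nonempty (part i)
    cover : ∀ x → ∃! _≡_ λ i → x ∈ part i

module _ {n : ℕ} (M : Matroid n) where
  open Matroid M

  rankOf : Subset n → ℕ
  rankOf S = max 0 (map ∣_∣ (filter independent? (filter (_⊆? S) (subsets n))))

  rank : ℕ
  rank = rankOf ⊤

  InClosure : Subset n → Fin n → Set
  InClosure S x = rankOf (S ∪ ⁅ x ⁆) ≡ rankOf S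

  IsFlat : Subset n → Set
  IsFlat S = ∀ x → InClosure S x → x ∈ S

  IsLoop : Fin n → Set
  IsLoop x = ¬ Independent ⁅ x ⁆

  -- Two distinct elements in a common parallel class.
  Parallel : Fin n → Fin n → Set
  Parallel x y = x ≢ y × ¬ IsLoop x × ¬ IsLoop y × ¬ Independent (⁅ x ⁆ ∪ ⁅ y ⁆)

  IsSimple : Set
  IsSimple = (∀ x → ¬ IsLoop x) × (∀ x y → ¬ Parallel x y)

  -- The m ≤ p distinct chosen parts are given by an injection e, and the
  -- element chosen from the part e j is c j.
  IsPIndependentPartition : ℕ → Partition n → Set
  IsPIndependentPartition p π =
    ∀ m → m ≤ p →
    (e : Fin m → Fin size) → Injective _≡_ _≡_ e →
    (c : Fin m → Fin n) → (∀ j → c j ∈ part (e j)) →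
    Independent (⋃ (tabulate λ j → ⁅ c j ⁆))
    where open Partition π

  IsIndependentPartition : Partition n → Set
  IsIndependentPartition = IsPIndependentPartition (suc rank)

  -- Of interest for 3 ≤ p ≤ rank.
  IsPIndependent : ℕ → Set
  IsPIndependent p = ∀ π → IsPIndependentPartition p π → IsIndependentPartition π

  -- In a simple matroid the 3-circuits are exactly the dependent 3-element sets.
  Is3Circuit : Subset n → Set
  Is3Circuit C = ∣ C ∣ ≡ 3 × ¬ Independent C

  IsLineClosedSet : Subset n → Set
  IsLineClosedSet S = ∀ C → Is3Circuit C → 2 ≤ ∣ S ∩ C ∣ → C ⊆ S

  IsLineClosed : Set
  IsLineClosed = ∀ S → IsLineClosedSet S → IsFlat S

{-# OPTIONS --safe #-}
-- Intersecting a line-closed set S of rank k with the spans of the initial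
-- segments of a basis b₁ , … , b_k of S gives a chain of line-closed sets with
-- top S.  The successive differences of such a chain, together with the
-- complement of S, form a 3-independent partition: if a, b, c are collinear and
-- c lies strictly higher in the chain than a and b, then a line-closed set
-- contains a and b but not c.  If x ∉ S, then x , b_k , … , b₁ is a transversal of
-- the k + 1 parts, so 3-independence makes it independent, and S ∪ {x} has rank
-- greater than k.
module Submission where

open import Defs
import Data.Empty as Empty
open import Data.Fin.Base using (Fin; zero; suc; _<_)
open import Data.Fin.Properties using (_≟_; <-cmp; <-trans)
open import Data.Fin.Subset
  using (Subset; inside; outside; ⊥; ⁅_⁆; _∈_; _∉_; _⊆_; _∪_; _∩_; ⋃; ∣_∣)
open import Data.Fin.Subset.Properties
open import Data.List.Base using (map; filter; tabulate)
open import Data.List.Extrema.Nat using (argmax-sel; xs≤max)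
open import Data.List.Membership.Propositional using () renaming (_∈_ to _∈ˡ_)
open import Data.List.Membership.Propositional.Properties
  using (∈-++⁺ˡ; ∈-++⁺ʳ; ∈-map⁺; ∈-map⁻; ∈-filter⁺; ∈-filter⁻)
import Data.List.Relation.Unary.All as All
open import Data.List.Relation.Unary.Any using (here)
open import Data.Nat.Base using (ℕ; zero; suc; _+_; _≤_; s≤s; s<s⁻¹) renaming (_<_ to _<ⁿ_)
import Data.Nat.Properties as ℕ
open import Data.Product.Base using (∃; _×_; _,_; proj₁; proj₂)
open import Data.Sum.Base using (inj₁; inj₂)
open import Data.Unit.Base using (⊤; tt)
import Data.Vec.Base as Vec
open import Data.Vec.Functional using (Vector; []; _∷_; head; tail)
open import Data.Vec.Properties using (lookup∘tabulate; []=⇒lookup; lookup⇒[]=)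
open import Function.Base using (id; _∘_)
open import Level using (0ℓ)
open import Relation.Binary.Definitions using (tri<; tri≈; tri>)
open import Relation.Binary.PropositionalEquality
open import Relation.Nullary.Decidable
  using (does; proof; yes; no; ¬?; _×-dec_; decidable-stable; dec-true)
open import Relation.Nullary.Negation using (¬_; contradiction)
open import Relation.Nullary.Reflects using (Reflects; invert)
open import Relation.Unary using (Pred; Decidable)

private
  variable
    n k : ℕ

-- Finite subsets and their enumeration by vectors.

∣⁅x⁆∪p∣≡1+∣p∣ : ∀ {x : Fin n} {p} → x ∉ p → ∣ ⁅ x ⁆ ∪ p ∣ ≡ suc ∣ p ∣
∣⁅x⁆∪p∣≡1+∣p∣ {x = zero}  {outside Vec.∷ p} _   = cong (suc ∘ ∣_∣) (∪-identityˡ p)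
∣⁅x⁆∪p∣≡1+∣p∣ {x = zero}  {inside  Vec.∷ p} x∉p = contradiction Vec.here x∉p
∣⁅x⁆∪p∣≡1+∣p∣ {x = suc x} {outside Vec.∷ p} x∉p = ∣⁅x⁆∪p∣≡1+∣p∣ (x∉p ∘ Vec.there)
∣⁅x⁆∪p∣≡1+∣p∣ {x = suc x} {inside  Vec.∷ p} x∉p = cong suc (∣⁅x⁆∪p∣≡1+∣p∣ (x∉p ∘ Vec.there))

∈-subsets : (p : Subset n) → p ∈ˡ subsets n
∈-subsets Vec.[]              = here refl
∈-subsets (outside Vec.∷ p) = ∈-++⁺ˡ (∈-map⁺ _ (∈-subsets p))
∈-subsets (inside  Vec.∷ p) = ∈-++⁺ʳ (map (outside Vec.∷_) (subsets _)) (∈-map⁺ _ (∈-subsets p))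

-- This is literally the union in `IsPIndependentPartition`, so a choice of elements from parts
-- needs no conversion.
⟨_⟩ : Vector (Fin n) k → Subset n
⟨ v ⟩ = ⋃ (tabulate λ i → ⁅ v i ⁆)

lookup∈⟨⟩ : (v : Vector (Fin n) k) → ∀ i → v i ∈ ⟨ v ⟩
lookup∈⟨⟩ v zero    = x∈p∪q⁺ (inj₁ (x∈⁅x⁆ _))
lookup∈⟨⟩ v (suc i) = x∈p∪q⁺ (inj₂ (lookup∈⟨⟩ (tail v) i))

∈⟨⟩⁻ : ∀ {x} (v : Vector (Fin n) k) → x ∈ ⟨ v ⟩ → ∃ λ i → v i ≡ x
∈⟨⟩⁻ {k = zero}  v x∈ = contradiction x∈ ∉⊥
∈⟨⟩⁻ {k = suc _} v x∈ with x∈p∪q⁻ _ _ x∈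
... | inj₁ x∈⁅v₀⁆ = zero , sym (x∈⁅y⁆⇒x≡y _ x∈⁅v₀⁆)
... | inj₂ x∈⟨v⟩ with ∈⟨⟩⁻ (tail v) x∈⟨v⟩
...   | i , vᵢ≡x = suc i , vᵢ≡x

⟨⟩⊆ : ∀ {p} (v : Vector (Fin n) k) → (∀ i → v i ∈ p) → ⟨ v ⟩ ⊆ p
⟨⟩⊆ {p = p} v v∈p x∈ with ∈⟨⟩⁻ v x∈
... | i , vᵢ≡x = subst (_∈ p) vᵢ≡x (v∈p i)

-- Partitions from colourings.

fibre : (Fin n → Fin k) → Fin k → Subset n
fibre f i = Vec.tabulate λ y → does (f y ≟ i)

∈-fibre⁺ : ∀ (f : Fin n → Fin k) {i y} → f y ≡ i → y ∈ fibre f i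
∈-fibre⁺ f {i} {y} fy≡i =
  lookup⇒[]= y _ (trans (lookup∘tabulate _ y) (dec-true (f y ≟ i) fy≡i))

∈-fibre⁻ : ∀ (f : Fin n → Fin k) {i y} → y ∈ fibre f i → f y ≡ i
∈-fibre⁻ f {i} {y} y∈ = invert (subst (Reflects _)
  (trans (sym (lookup∘tabulate _ y)) ([]=⇒lookup y∈)) (proof (f y ≟ i)))

-- The section `g` makes every part nonempty, as `Partition` requires. In the final argument it is
-- also the transversal whose independence is wanted.
fibres : (f : Fin n → Fin k) (g : Fin k → Fin n) → (∀ i → f (g i) ≡ i) → Partition n
fibres f g f∘g≗id = record
  { size     = _
  ; part     = fibre f
  ; nonempty = λ i → g i , ∈-fibre⁺ f (f∘g≗id i)
  ; cover    = λ x → f x , ∈-fibre⁺ f refl , ∈-fibre⁻ f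
  }

-- Rank and exchange.

module _ (M : Matroid n) where
  open Matroid M

  ∣I∣≤rankOf : ∀ {I S} → Independent I → I ⊆ S → ∣ I ∣ ≤ rankOf M S
  ∣I∣≤rankOf I-ind I⊆S = All.lookup (xs≤max 0 _)
    (∈-map⁺ ∣_∣ (∈-filter⁺ independent? (∈-filter⁺ (_⊆? _) (∈-subsets _) I⊆S) I-ind))

  rankOf-attained : ∀ S → ∃ λ I → Independent I × I ⊆ S × ∣ I ∣ ≡ rankOf M S
  rankOf-attained S
    with argmax-sel id 0 (map ∣_∣ (filter independent? (filter (_⊆? S) (subsets n))))
  -- The maximum may be the default `0`, which the empty set attains.
  ... | inj₁ max≡0 = ⊥ , ⊥-independent , (λ x∈⊥ → contradiction x∈⊥ ∉⊥) , trans (∣⊥∣≡0 n) (sym max≡0)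
  ... | inj₂ max∈ with ∈-map⁻ ∣_∣ max∈
  ...   | I , I∈ , max≡∣I∣ with ∈-filter⁻ independent? {xs = filter (_⊆? S) (subsets n)} I∈
  ...     | I∈′ , I-ind = I , I-ind , proj₂ (∈-filter⁻ (_⊆? S) {xs = subsets n} I∈′) , sym max≡∣I∣

  -- With the new element on the left, the case `I = ⟨ v ⟩` yields `⟨ x ∷ v ⟩` by unfolding.
  exchangeˡ : ∀ {I J} → Independent I → Independent J → ∣ I ∣ <ⁿ ∣ J ∣ →
              ∃ λ x → x ∈ J × x ∉ I × Independent (⁅ x ⁆ ∪ I)
  exchangeˡ {I} I-ind J-ind ∣I∣<∣J∣ with exchange I-ind J-ind ∣I∣<∣J∣
  ... | x , x∈J , x∉I , ind = x , x∈J , x∉I , subst Independent (∪-comm I ⁅ x ⁆) ind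

  augment : ∀ {I J} → Independent I → Independent J →
            ∃ λ K → Independent K × I ⊆ K × K ⊆ I ∪ J × ∣ J ∣ ≤ ∣ K ∣
  augment {I} {J} I-ind J-ind = go ∣ J ∣ (ℕ.m≤n+m ∣ J ∣ ∣ I ∣) I-ind
    where
    -- `d` bounds the number of exchanges still to be made; `∣ J ∣` of them always suffice.
    go : ∀ d {I} → ∣ J ∣ ≤ ∣ I ∣ + d → Independent I →
         ∃ λ K → Independent K × I ⊆ K × K ⊆ I ∪ J × ∣ J ∣ ≤ ∣ K ∣
    go zero {I} ∣J∣≤ I-ind =
      I , I-ind , id , p⊆p∪q J , subst (∣ J ∣ ≤_) (ℕ.+-identityʳ _) ∣J∣≤
    go (suc d) {I} ∣J∣≤ I-ind with ∣ J ∣ ℕ.≤? ∣ I ∣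
    ... | yes ∣J∣≤∣I∣ = I , I-ind , id , p⊆p∪q J , ∣J∣≤∣I∣
    ... | no  ∣J∣≰∣I∣ with exchangeˡ I-ind J-ind (ℕ.≰⇒> ∣J∣≰∣I∣)
    ...   | x , x∈J , x∉I , xI-ind
      with go d (subst (∣ J ∣ ≤_) (trans (ℕ.+-suc _ d) (cong (_+ d) (sym (∣⁅x⁆∪p∣≡1+∣p∣ x∉I)))) ∣J∣≤) xI-ind
    ...     | K , K-ind , xI⊆K , K⊆ , ∣J∣≤∣K∣ =
      K , K-ind , xI⊆K ∘ q⊆p∪q _ _ , K⊆I∪J , ∣J∣≤∣K∣
      where
      K⊆I∪J : K ⊆ I ∪ J
      K⊆I∪J y∈K with x∈p∪q⁻ _ _ (K⊆ y∈K)
      ... | inj₂ y∈J = x∈p∪q⁺ (inj₂ y∈J)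
      ... | inj₁ y∈xI with x∈p∪q⁻ _ _ y∈xI
      ...   | inj₁ y∈⁅x⁆ rewrite x∈⁅y⁆⇒x≡y _ y∈⁅x⁆ = x∈p∪q⁺ (inj₂ x∈J)
      ...   | inj₂ y∈I = x∈p∪q⁺ (inj₁ y∈I)

  -- Ordered independent sets and their spans.

  Fresh : Vector (Fin n) k → Pred (Fin n) 0ℓ
  Fresh v x = x ∉ ⟨ v ⟩ × Independent (⁅ x ⁆ ∪ ⟨ v ⟩)

  -- For independent `⟨ v ⟩` this is membership in the closure, phrased without ranks. The clause
  -- `x ∉ ⟨ v ⟩` of `Fresh` is what makes the entries of `v` themselves spanned.
  Spanned : Vector (Fin n) k → Pred (Fin n) 0ℓ
  Spanned v x = ¬ Fresh v x

  spanned? : (v : Vector (Fin n) k) → Decidable (Spanned v)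
  spanned? v x = ¬? (¬? (x ∈? ⟨ v ⟩) ×-dec independent? _)

  spanned-lookup : (v : Vector (Fin n) k) → ∀ i → Spanned v (v i)
  spanned-lookup v i (vᵢ∉⟨v⟩ , _) = vᵢ∉⟨v⟩ (lookup∈⟨⟩ v i)

  -- Freeness passes to every tail, hence to all the spans in the chain, and it includes
  -- distinctness of the entries, so that sizes can be counted.
  Free : Vector (Fin n) k → Set
  Free {k = zero}  v = ⊤
  Free {k = suc _} v = Fresh (tail v) (head v) × Free (tail v)

  free⇒independent : (v : Vector (Fin n) k) → Free v → Independent ⟨ v ⟩
  free⇒independent {k = zero}  v _                = ⊥-independent
  free⇒independent {k = suc _} v ((_ , ind) , _) = ind

  free⇒∣⟨⟩∣ : (v : Vector (Fin n) k) → Free v → ∣ ⟨ v ⟩ ∣ ≡ k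
  free⇒∣⟨⟩∣ {k = zero}  v _                   = ∣⊥∣≡0 n
  free⇒∣⟨⟩∣ {k = suc _} v ((∉⟨⟩ , _) , free) =
    trans (∣⁅x⁆∪p∣≡1+∣p∣ ∉⟨⟩) (cong suc (free⇒∣⟨⟩∣ (tail v) free))

  freeVector : ∀ {J} → Independent J → ∀ k → k ≤ ∣ J ∣ →
               ∃ λ (v : Vector (Fin n) k) → Free v × (∀ i → v i ∈ J)
  freeVector J-ind zero    _    = [] , tt , λ ()
  freeVector {J} J-ind (suc k) k<∣J∣ with freeVector J-ind k (ℕ.<⇒≤ k<∣J∣)
  ... | v , free , v∈J
    with exchangeˡ (free⇒independent v free) J-ind
           (subst (_<ⁿ ∣ J ∣) (sym (free⇒∣⟨⟩∣ v free)) k<∣J∣)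
  ...   | x , x∈J , fresh = x ∷ v , (fresh , free) , λ { zero → x∈J ; (suc i) → v∈J i }

  -- Collinear triples and colourings along a chain of spans.

  Collinear : Fin n → Fin n → Fin n → Set
  Collinear a b c = a ≢ b × b ≢ c × c ≢ a × ¬ Independent ⟨ a ∷ b ∷ c ∷ [] ⟩

  collinear-rotate : ∀ {a b c} → Collinear a b c → Collinear b c a
  collinear-rotate (a≢b , b≢c , c≢a , dep) = b≢c , c≢a , a≢b , dep ∘ hereditary
    (⟨⟩⊆ (_ ∷ _ ∷ _ ∷ []) λ
             { zero             → lookup∈⟨⟩ (_ ∷ _ ∷ _ ∷ []) (suc (suc zero))
             ; (suc zero)       → lookup∈⟨⟩ (_ ∷ _ ∷ _ ∷ []) zero
             ; (suc (suc zero)) → lookup∈⟨⟩ (_ ∷ _ ∷ _ ∷ []) (suc zero) })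

  -- Stated for predicates so that it covers both `S` and `Spanned v`.
  CollinearClosed : Pred (Fin n) 0ℓ → Set
  CollinearClosed T = ∀ {a b c} → Collinear a b c → T a → T b → T c

  lineClosed⇒collinearClosed : ∀ {S} → IsLineClosedSet M S → CollinearClosed (_∈ S)
  lineClosed⇒collinearClosed {S} closed {a} {b} {c} (a≢b , b≢c , c≢a , dep) a∈S b∈S =
    closed ⟨ v ⟩ (∣v∣≡3 , dep) 2≤∣S∩v∣ (lookup∈⟨⟩ v (suc (suc zero)))
    where
    v : Vector (Fin n) 3
    v = a ∷ b ∷ c ∷ []
    ∣⟨x⟩∣≡1 : ∀ x → ∣ ⟨ x ∷ [] ⟩ ∣ ≡ 1
    ∣⟨x⟩∣≡1 x = trans (cong ∣_∣ (∪-identityʳ ⁅ x ⁆)) (∣⁅x⁆∣≡1 x)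
    ∣⟨x,y⟩∣≡2 : ∀ {x y} → x ≢ y → ∣ ⟨ x ∷ y ∷ [] ⟩ ∣ ≡ 2
    ∣⟨x,y⟩∣≡2 {x} {y} x≢y = trans (∣⁅x⁆∪p∣≡1+∣p∣ x∉) (cong suc (∣⟨x⟩∣≡1 y))
      where
      x∉ : x ∉ ⟨ y ∷ [] ⟩
      x∉ x∈ with ∈⟨⟩⁻ (y ∷ []) x∈
      ... | zero , y≡x = x≢y (sym y≡x)
    a∉ : a ∉ ⟨ b ∷ c ∷ [] ⟩
    a∉ a∈ with ∈⟨⟩⁻ (b ∷ c ∷ []) a∈
    ... | zero     , b≡a = a≢b (sym b≡a)
    ... | suc zero , c≡a = c≢a c≡a
    ∣v∣≡3 : ∣ ⟨ v ⟩ ∣ ≡ 3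
    ∣v∣≡3 = trans (∣⁅x⁆∪p∣≡1+∣p∣ a∉) (cong suc (∣⟨x,y⟩∣≡2 b≢c))
    ab⊆S∩v : ⟨ a ∷ b ∷ [] ⟩ ⊆ S ∩ ⟨ v ⟩
    ab⊆S∩v = ⟨⟩⊆ (a ∷ b ∷ []) λ
      { zero       → x∈p∩q⁺ (a∈S , lookup∈⟨⟩ v zero)
      ; (suc zero) → x∈p∩q⁺ (b∈S , lookup∈⟨⟩ v (suc zero)) }
    2≤∣S∩v∣ : 2 ≤ ∣ S ∩ ⟨ v ⟩ ∣
    2≤∣S∩v∣ = subst (_≤ ∣ S ∩ ⟨ v ⟩ ∣) (∣⟨x,y⟩∣≡2 a≢b) (p⊆q⇒∣p∣≤∣q∣ ab⊆S∩v)

  -- The colour classes are the successive differences of the chain of sets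
  -- [n] ⊇ T ⊇ T ∩ span (v₂ , … , v_k) ⊇ T ∩ span (v₃ , … , v_k) ⊇ … ⊇ T ∩ span (v_k),
  -- numbered from the outside in.
  colour : {T : Pred (Fin n) 0ℓ} → Decidable T → Vector (Fin n) k → Fin n → Fin (suc k)
  colour {k = zero}  T? v y = zero
  colour {k = suc _} T? v y with T? y
  ... | no  _ = zero
  ... | yes _ = suc (colour (spanned? (tail v)) (tail v) y)

  -- The element `x` is outside `T`, so it gets colour zero. The head of `v` is in `T` but, by
  -- freeness, outside the span of the tail, so it takes the place of `x` one level down. Thus
  -- `x ∷ v` has exactly one entry in each class.
  colour-∷ : {T : Pred (Fin n) 0ℓ} (T? : Decidable T) (v : Vector (Fin n) k) → Free v →
             (∀ i → T (v i)) → ∀ {x} → ¬ T x → ∀ i → colour T? v ((x ∷ v) i) ≡ i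
  colour-∷ {k = zero}  T? v free v∈T x∉T zero = refl
  colour-∷ {k = suc _} T? v free v∈T {x} x∉T zero with T? x
  ... | yes x∈T = contradiction x∈T x∉T
  ... | no  _   = refl
  colour-∷ {k = suc _} T? v (fresh , free) v∈T x∉T (suc i) with T? (v i)
  ... | no  vᵢ∉T = contradiction (v∈T i) vᵢ∉T
  ... | yes _    = cong suc (trans (cong (colour _ (tail v)) (∷-η i))
      (colour-∷ (spanned? (tail v)) (tail v) free (spanned-lookup (tail v)) (λ spanned → spanned fresh) i))
    where
    ∷-η : ∀ i → v i ≡ (head v ∷ tail v) i
    ∷-η zero    = refl
    ∷-η (suc i) = refl

  -- The 3-independent partition in a simple matroid.

  module _ (simple : IsSimple M) where

    singleton-independent : ∀ x → Independent ⁅ x ⁆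
    singleton-independent x = decidable-stable (independent? _) (proj₁ simple x)

    pair-independent : ∀ {x y} → x ≢ y → Independent ⟨ x ∷ y ∷ [] ⟩
    pair-independent {x} {y} x≢y = subst (λ p → Independent (⁅ x ⁆ ∪ p)) (sym (∪-identityʳ _))
      (decidable-stable (independent? _) λ dep →
        proj₂ simple x y (x≢y , proj₁ simple x , proj₁ simple y , dep))

    -- If c is fresh for v, extend {a , b} to an independent K ⊆ {a , b , c} ∪ v larger
    -- than v.  Then K exchanges an element into v, which can only be c, so K ⊇ {a , b , c}.
    spanned-collinearClosed : (v : Vector (Fin n) k) → Free v → CollinearClosed (Spanned v)
    spanned-collinearClosed v free {a} {b} {c} (a≢b , _ , _ , dep) a-sp b-sp (c∉⟨v⟩ , cv-ind)
      with augment (pair-independent a≢b) cv-ind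
    ... | K , K-ind , ab⊆K , K⊆ , ∣cv∣≤∣K∣
      with exchangeˡ (free⇒independent v free) K-ind
             (subst (_≤ ∣ K ∣) (∣⁅x⁆∪p∣≡1+∣p∣ c∉⟨v⟩) ∣cv∣≤∣K∣)
    ...   | z , z∈K , z∉⟨v⟩ , zv-ind with x∈p∪q⁻ _ _ (K⊆ z∈K)
    ...     | inj₁ z∈ab = pair-spanned (∈⟨⟩⁻ (a ∷ b ∷ []) z∈ab) (z∉⟨v⟩ , zv-ind)
      where
      pair-spanned : ∀ {z} → (∃ λ i → (a ∷ b ∷ []) i ≡ z) → Spanned v z
      pair-spanned (zero     , refl) = a-sp
      pair-spanned (suc zero , refl) = b-sp
    ...     | inj₂ z∈cv with x∈p∪q⁻ _ _ z∈cv
    ...       | inj₂ z∈⟨v⟩ = z∉⟨v⟩ z∈⟨v⟩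
    ...       | inj₁ z∈⁅c⁆ = dep (hereditary
      (⟨⟩⊆ (a ∷ b ∷ c ∷ []) λ
        { zero             → ab⊆K (lookup∈⟨⟩ (a ∷ b ∷ []) zero)
        ; (suc zero)       → ab⊆K (lookup∈⟨⟩ (a ∷ b ∷ []) (suc zero))
        ; (suc (suc zero)) → subst (_∈ K) (x∈⁅y⁆⇒x≡y _ z∈⁅c⁆) z∈K }) K-ind)

    -- Induction along the chain from the outside. The strict inequalities force `a` and `b` into
    -- `T`, and closedness then forces `c` into `T`. All three colours drop by one, and the span of
    -- the tail, again closed, takes over as `T`.
    colour-no-strict-min : ∀ {T} (T? : Decidable T) → CollinearClosed T →
      (v : Vector (Fin n) k) → Free v → ∀ {a b c} → Collinear a b c →
      colour T? v c < colour T? v a → ¬ colour T? v c < colour T? v b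
    colour-no-strict-min {k = zero} T? closed v free abc ()
    colour-no-strict-min {k = suc _} T? closed v (_ , free) {a} {b} {c} abc c<a c<b
      with T? a | T? b | T? c
    ... | no _    | _       | _      = contradiction c<a λ ()
    ... | yes _   | no _    | _      = contradiction c<b λ ()
    ... | yes a∈T | yes b∈T | no c∉T = c∉T (closed abc a∈T b∈T)
    ... | yes _   | yes _   | yes _  =
      colour-no-strict-min (spanned? (tail v)) (spanned-collinearClosed (tail v) free)
        (tail v) free abc (s<s⁻¹ c<a) (s<s⁻¹ c<b)

    -- Simplicity settles choices of at most two elements. A dependent choice of three would be a
    -- collinear triple with distinct colours, so one of the colours would be a strict minimum.
    3-independent : (f : Fin n → Fin k) (g : Fin k → Fin n) (f∘g≗id : ∀ i → f (g i) ≡ i) →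
      (∀ {a b c} → Collinear a b c → f c < f a → ¬ f c < f b) →
      IsPIndependentPartition M 3 (fibres f g f∘g≗id)
    3-independent f g f∘g≗id no-min m m≤3 e e-inj c c∈ = go m m≤3 e e-inj c (∈-fibre⁻ f ∘ c∈)
      where
      go : ∀ m → m ≤ 3 → (e : Fin m → Fin _) → (∀ {i j} → e i ≡ e j → i ≡ j) →
           (c : Fin m → Fin n) → (∀ j → f (c j) ≡ e j) → Independent ⟨ c ⟩
      go 0 _ e e-inj c fc≡e = ⊥-independent
      go 1 _ e e-inj c fc≡e =
        subst Independent (sym (∪-identityʳ _)) (singleton-independent (c zero))
      go 2 _ e e-inj c fc≡e = pair-independent λ c₀≡c₁ →
        contradiction (e-inj (trans (sym (fc≡e zero)) (trans (cong f c₀≡c₁) (fc≡e (suc zero))))) λ ()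
      go 3 _ e e-inj c fc≡e = decidable-stable (independent? _) dependent⇒⊥
        where
        f∘c-inj : ∀ {i j} → f (c i) ≡ f (c j) → i ≡ j
        f∘c-inj {i} {j} eq = e-inj (trans (sym (fc≡e i)) (trans eq (fc≡e j)))
        distinct : ∀ {i j} → i ≢ j → c i ≢ c j
        distinct i≢j cᵢ≡cⱼ = i≢j (f∘c-inj (cong f cᵢ≡cⱼ))
        dependent⇒⊥ : ¬ ¬ Independent ⟨ c ⟩
        dependent⇒⊥ dep = by-minimum
          where
          collinear : Collinear (c zero) (c (suc zero)) (c (suc (suc zero)))
          collinear = distinct (λ ()) , distinct (λ ()) , distinct (λ ()) , dep
          by-minimum : Empty.⊥
          by-minimum
            -- Each case without a tie singles out the smallest colour; rotation brings its element
            -- to the third place, where `no-min` expects it.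
            with <-cmp (f (c zero)) (f (c (suc zero)))
               | <-cmp (f (c zero)) (f (c (suc (suc zero))))
               | <-cmp (f (c (suc zero))) (f (c (suc (suc zero))))
          ... | tri≈ _ eq _  | _            | _            = contradiction (f∘c-inj eq) λ ()
          ... | _            | tri≈ _ eq _  | _            = contradiction (f∘c-inj eq) λ ()
          ... | _            | _            | tri≈ _ eq _  = contradiction (f∘c-inj eq) λ ()
          ... | tri< 0<1 _ _ | tri< 0<2 _ _ | _            = no-min (collinear-rotate collinear) 0<1 0<2
          ... | tri> _ _ 1<0 | _            | tri< 1<2 _ _ =
            no-min (collinear-rotate (collinear-rotate collinear)) 1<2 1<0
          ... | tri< 0<1 _ _ | tri> _ _ 2<0 | _            = no-min collinear 2<0 (<-trans 2<0 0<1)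
          ... | tri> _ _ 1<0 | _            | tri> _ _ 2<1 = no-min collinear (<-trans 2<1 1<0) 2<1
      go (suc (suc (suc (suc _)))) (s≤s (s≤s (s≤s ())))

    lineClosed⇒flat : IsPIndependent M 3 → IsLineClosed M
    lineClosed⇒flat M-3-ind S S-closed x x∈cl = decidable-stable (x ∈? S) λ x∉S →
      let
        J , J-ind , J⊆S , ∣J∣≡rank = rankOf-attained S
        -- Length `∣ J ∣` makes `v` an ordering of the whole basis `J` of `S`.
        v , v-free , v∈J = freeVector J-ind ∣ J ∣ ℕ.≤-refl
        v∈S = J⊆S ∘ v∈J
        f∘[x∷v]≗id = colour-∷ (_∈? S) v v-free v∈S x∉S
        π-ind = M-3-ind (fibres (colour (_∈? S) v) (x ∷ v) f∘[x∷v]≗id)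
          (3-independent _ (x ∷ v) f∘[x∷v]≗id
            (colour-no-strict-min (_∈? S) (lineClosed⇒collinearClosed S-closed) v v-free))
        xv-ind : Independent ⟨ x ∷ v ⟩
        -- All `suc ∣ J ∣` parts are chosen, which the bound `suc (rank M)` permits because `J` is
        -- independent.
        xv-ind = π-ind (suc ∣ J ∣) (s≤s (∣I∣≤rankOf J-ind (⊆-max J))) id id (x ∷ v)
          (λ i → ∈-fibre⁺ (colour (_∈? S) v) (f∘[x∷v]≗id i))
        xv⊆ : ⟨ x ∷ v ⟩ ⊆ S ∪ ⁅ x ⁆
        xv⊆ = ⟨⟩⊆ (x ∷ v) λ { zero    → x∈p∪q⁺ (inj₂ (x∈⁅x⁆ x))
                             ; (suc i) → x∈p∪q⁺ (inj₁ (v∈S i)) }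
        xv-free : Free (x ∷ v)
        xv-free = (x∉S ∘ ⟨⟩⊆ v v∈S , xv-ind) , v-free
      -- Now `suc ∣ J ∣` is at most the rank of `S ∪ ⁅ x ⁆`, which equals the rank of `S`, that is,
      -- `∣ J ∣`.
      in ℕ.<-irrefl (trans ∣J∣≡rank (sym x∈cl))
           (subst (_≤ rankOf M (S ∪ ⁅ x ⁆)) (free⇒∣⟨⟩∣ (x ∷ v) xv-free) (∣I∣≤rankOf xv-ind xv⊆))

theorem4p4 : ∀ (n ℓ : ℕ) (M : Matroid n) → IsSimple M → rank M ≡ ℓ → 3 ≤ ℓ →
    IsPIndependent M 3 → IsLineClosed M
theorem4p4 n ℓ M simple _ _ = lineClosed⇒flat M simple
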